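{- Let $\mathcal D$ be either the category $\mathsf{sSet}_+$ of semi-simplicial sets or the category $\mathsf{sSet}$ of simplicial sets. Let $w=w_0w_1w_2\cdots\in\{0,1\}^\omega$ be an infinite binary word; if $\mathcal D=\mathsf{sSet}$, suppose additionally that $w$ is of the form $0^\omega$ or $0^m1^\omega$ for some $m\in\mathbb N$. Let $j^w\colon\Omega\to\Omega$ be defined by $j^w_n:=j^{w_0\cdots w_n}_n$ for all $n\in\mathbb N$, where $j^{w_0\cdots w_n}$ is the corresponding topology on the $n$-dimensional version $\mathcal D^{\leq n}$ of $\mathcal D$. Then $j^w$ is a Lawvere-Tierney topology on $\mathcal D$. Moreover, all Lawvere-Tierney topologies on $\mathcal D$ are of this form.
   Context: $\mathbb N$ contains $0$. $\Delta$ is the simplex category: objects $k\in\mathbb N$ ($k$ standing for the ordinal $\{0<\dots<k\}$), monotone maps; $\Delta_+$ is the wide subcategory of injective monotone maps; $\Delta^{\leq n}$ and $\Delta^{\leq n}_+$ are their full subcategories on $0,\dots,n$. In the opposite category, $d_i=d^k_i\colon k\to k-1$ is the opposite of the injection omitting $i$, and $s_i=s^k_i\colon k\to k+1$ is the opposite of the monotone surjection hitting $i$ twice ($0\le i\le k$). $\mathsf{sSet},\mathsf{sSet}_+,\mathsf{sSet}^{\leq n},\mathsf{sSet}^{\leq n}_+$ are the categories of presheaves of sets on $\Delta,\Delta_+,\Delta^{\leq n},\Delta^{\leq n}_+$ respectively. For $\mathcal D=\mathsf{sSet}$ (resp. $\mathsf{sSet}_+$), $\mathcal D^{\leq n}=\mathsf{sSet}^{\leq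 n}$ (resp. $\mathsf{sSet}^{\leq n}_+$). In each of these categories, with Yoneda embedding $y$, the classifying object is the presheaf $\Omega$ with $\Omega(k)$ the Heyting algebra of subpresheaves of $y(k)$, and $\Omega(f)$ (for $f\colon k\to l$ in the opposite index category) is pullback along $y(f^{\mathrm{op}})\colon y(l)\to y(k)$. A (Lawvere-Tierney) topology is a natural transformation $j\colon\Omega\to\Omega$ that, at each $k$, preserves the top element, is idempotent, and preserves binary meets. For $k\le n$, $\Omega(k)$ computed in $\mathcal D$, in $\mathcal D^{\leq n}$ and in $\mathcal D^{\leq k}$ are identified via restriction to lower dimensions (a bijection). Topologies $j^w$ on $\mathsf{sSet}^{\leq n}_+$, $w\in\{0,1\}^{n+1}$. Write $y_+,\Omega_+$ for $y,\Omega$ in the semi-simplicial case. $y_+(k)^\partial$ is the union of the faces of $y_+(k)$, where the $i$-th face is the least subpresheaf of $y_+(k)$ containing $d^k_i$; $y_+(0)^\partial=\emptyset$. The incidence tuple of $x\in\Omega_+(k+1)$ is $(\Omega_+(d_{k+1})(x),\dots,\Omega_+(d_0)(x))$. For $n=0$, $\Omega_+(0)=\{\emptyset,y_+(0)\}$, $j^0$ is the identity and $j^1$ is constant with value $y_+(0)$. Given $j^w$ with $w\in\{0,1\}^{n+1}$ and a bit $b$, put $j=j^{wb}$ with $j_k=j^w_k$ for $k\le n$, and: $j_{n+1}(y_+(n+1))=y_+(n+1)$; $j_{n+1}(y_+(n+1)^\partial)=y_+(n+1)^\partial$ if $b=0$ and $=y_+(n+1)$ if $b=1$; for $x<y_+(n+1)^\partial$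 let $\vec z=(j_n\Omega_+(d_{n+1})(x),\dots,j_n\Omega_+(d_0)(x))$. If $\vec z\ne(y_+(n),\dots,y_+(n))$, $j_{n+1}(x)$ is the unique element with incidence tuple $\vec z$; otherwise $j_{n+1}(x)=y_+(n+1)^\partial$ if $b=0$ and $=y_+(n+1)$ if $b=1$. Topologies $j^w$ on $\mathsf{sSet}^{\leq n}$, for $w=0^m1^{n+1-m}$, $0\le m\le n+1$: $j^w_k:=F_k\circ j^w_k\circ F_k^{ -1}$ (with $j^w$ on the right the topology on $\mathsf{sSet}^{\leq n}_+$), where $F_k\colon\Omega_+(k)\to\Omega(k)$ is the bijection adding all degeneracies: $F_k(x)(l)=x(l)\cup\mathrm{degen}(x,l)$, with $\mathrm{degen}(x,0)=\emptyset$ and $\mathrm{degen}(x,l+1)=\{s^l_i\circ f\mid f\in x(l)\cup\mathrm{degen}(x,l),\ 0\le i\le l\}$. -}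

module Defs where

open import Axiom.ExcludedMiddle using (ExcludedMiddle)
open import Data.Bool using (Bool; true; false; if_then_else_)
open import Data.Empty using (⊥)
open import Data.Fin using (Fin; zero; suc; inject₁; punchIn; punchOut; pinch)
import Data.Fin as Fin
import Data.Fin.Properties as Finₚ
open import Data.Nat using (ℕ; zero; suc; _≤′_; ≤′-refl; ≤′-step; s≤s; z≤n)
import Data.Nat as ℕ
import Data.Nat.Properties as ℕₚ
open import Data.Product using (∃; ∃₂; _×_; _,_; proj₁; proj₂)
open import Data.Sum using (_⊎_; inj₁; inj₂)
open import Data.Unit using (tt) renaming (⊤ to Unit)
open import Data.Vec using (Vec; []; _∷_; _∷ʳ_; init; last)
open import Function using (Inverse)
open import Function.Definitions using (Injective)
open import Level using (Level; 0ℓ; _⊔_) renaming (suc to lsuc)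
open import Relation.Binary using (Setoid; IsEquivalence; tri<; tri≈; tri>)
open import Relation.Binary.PropositionalEquality
  using (_≡_; _≢_; refl; sym; trans; cong; subst; _≗_)
open import Relation.Nullary using (¬_; yes; no; contradiction)
open import Relation.Nullary.Decidable using (¬?)

record Category : Set₁ where
  infix  4 _≈_
  infixr 9 _∘_
  field
    Obj       : Set
    _⇒_       : Obj → Obj → Set
    _≈_       : ∀ {A B} → A ⇒ B → A ⇒ B → Set
    id        : ∀ {A} → A ⇒ A
    _∘_       : ∀ {A B C} → B ⇒ C → A ⇒ B → A ⇒ C
    equiv     : ∀ {A B} → IsEquivalence (_≈_ {A} {B})
    ∘-cong    : ∀ {A B C} {f f′ : B ⇒ C} {g g′ : A ⇒ B} →
                f ≈ f′ → g ≈ g′ → f ∘ g ≈ f′ ∘ g′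
    identityˡ : ∀ {A B} (f : A ⇒ B) → id ∘ f ≈ f
    identityʳ : ∀ {A B} (f : A ⇒ B) → f ∘ id ≈ f
    assoc     : ∀ {A B C D} (f : C ⇒ D) (g : B ⇒ C) (h : A ⇒ B) →
                (f ∘ g) ∘ h ≈ f ∘ (g ∘ h)

  module ≈ {A B} = IsEquivalence (equiv {A} {B})

module _ (C : Category) where
  open Category C using (Obj; _⇒_; id; _∘_) renaming (_≈_ to _≈ᶜ_)

  record Presheaf (c e : Level) : Set (lsuc (c ⊔ e)) where
    field
      ob : Obj → Setoid c e

    infix 4 _≈_
    ∣_∣ : Obj → Set c
    ∣ A ∣ = Setoid.Carrier (ob A)

    _≈_ : ∀ {A} → ∣ A ∣ → ∣ A ∣ → Set e
    _≈_ {A} = Setoid._≈_ (ob A)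

    field
      restrict      : ∀ {A B} → A ⇒ B → ∣ B ∣ → ∣ A ∣
      restrict-cong : ∀ {A B} {f g : A ⇒ B} {x y : ∣ B ∣} →
                      f ≈ᶜ g → x ≈ y → restrict f x ≈ restrict g y
      restrict-id   : ∀ {A} (x : ∣ A ∣) → restrict id x ≈ x
      restrict-∘    : ∀ {A B D} (f : B ⇒ D) (g : A ⇒ B) (x : ∣ D ∣) →
                      restrict (f ∘ g) x ≈ restrict g (restrict f x)

module _ {C : Category} where
  open Category C using (Obj; _⇒_)
  open Presheaf

  record IsNatural {c e c′ e′ : Level} (X : Presheaf C c e) (Y : Presheaf C c′ e′)
                   (η : ∀ A → ∣_∣ X A → ∣_∣ Y A) : Set (c ⊔ e ⊔ e′) where
    field
      η-cong  : ∀ {A} {x x′ : ∣_∣ X A} → _≈_ X x x′ → _≈_ Y (η A x) (η A x′)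
      commute : ∀ {A B} (f : A ⇒ B) (x : ∣_∣ X B) →
                _≈_ Y (η A (restrict X f x)) (restrict Y f (η B x))

  record Subpresheaf (X : Presheaf C 0ℓ 0ℓ) : Set₁ where
    field
      mem          : ∀ {A} → ∣_∣ X A → Set
      mem-resp     : ∀ {A} {x x′ : ∣_∣ X A} → _≈_ X x x′ → mem x → mem x′
      mem-restrict : ∀ {A B} (f : A ⇒ B) {x : ∣_∣ X B} → mem x → mem (restrict X f x)

  open Subpresheaf public

  module _ {X : Presheaf C 0ℓ 0ℓ} where
    private module X {A} = Setoid (ob X A)

    infix 4 _⊆_ _≐_

    _⊆_ : Subpresheaf X → Subpresheaf X → Set
    U ⊆ V = ∀ {A} (x : ∣_∣ X A) → mem U x → mem V x

    _≐_ : Subpresheaf X → Subpresheaf X → Set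
    U ≐ V = U ⊆ V × V ⊆ U

    ≐-isEquivalence : IsEquivalence _≐_
    ≐-isEquivalence = record
      { refl  = (λ _ p → p) , (λ _ p → p)
      ; sym   = λ (p , q) → q , p
      ; trans = λ (p , q) (p′ , q′) → (λ x m → p′ x (p x m)) , (λ x m → q x (q′ x m))
      }

    -- The least subpresheaf containing a given element.
    ⟨_⟩ : ∀ {A} → ∣_∣ X A → Subpresheaf X
    ⟨_⟩ {A} a = record
      { mem          = λ {B} x → ∃ λ (f : B ⇒ A) → _≈_ X x (restrict X f a)
      ; mem-resp     = λ { e (f , p) → f , X.trans (X.sym e) p }
      ; mem-restrict = λ { g (f , p) → Category._∘_ C f g ,
          X.trans (restrict-cong X (Category.≈.refl C) p) (X.sym (restrict-∘ X f g a)) }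
      }

    ⋃ : {I : Set} → (I → Subpresheaf X) → Subpresheaf X
    ⋃ U = record
      { mem          = λ x → ∃ λ i → mem (U i) x
      ; mem-resp     = λ { e (i , p) → i , mem-resp (U i) e p }
      ; mem-restrict = λ { f (i , p) → i , mem-restrict (U i) f p }
      }

    infixr 7 _∩_
    _∩_ : Subpresheaf X → Subpresheaf X → Subpresheaf X
    U ∩ V = record
      { mem          = λ x → mem U x × mem V x
      ; mem-resp     = λ { e (p , q) → mem-resp U e p , mem-resp V e q }
      ; mem-restrict = λ { f (p , q) → mem-restrict U f p , mem-restrict V f q }
      }

  full : (X : Presheaf C 0ℓ 0ℓ) → Subpresheaf X
  full X = record { mem = λ _ → Unit ; mem-resp = λ _ _ → tt ; mem-restrict = λ _ _ → tt }

  empty : (X : Presheaf C 0ℓ 0ℓ) → Subpresheaf X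
  empty X = record { mem = λ _ → ⊥ ; mem-resp = λ _ p → p ; mem-restrict = λ _ p → p }

  module _ {X Y : Presheaf C 0ℓ 0ℓ} {η : ∀ A → ∣_∣ X A → ∣_∣ Y A} (nat : IsNatural X Y η) where
    open IsNatural nat
    private module Y {A} = Setoid (ob Y A)

    pullback : Subpresheaf Y → Subpresheaf X
    pullback V = record
      { mem          = λ {A} x → mem V (η A x)
      ; mem-resp     = λ e → mem-resp V (η-cong e)
      ; mem-restrict = λ f {x} p → mem-resp V (Y.sym (commute f x)) (mem-restrict V f p)
      }

    image : Subpresheaf X → Subpresheaf Y
    image U = record
      { mem          = λ {A} v → ∃ λ x → mem U x × _≈_ Y v (η A x)
      ; mem-resp     = λ { e (x , p , q) → x , p , Y.trans (Y.sym e) q }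
      ; mem-restrict = λ { f (x , p , q) → restrict X f x , mem-restrict U f p ,
          Y.trans (restrict-cong Y (Category.≈.refl C) q) (Y.sym (commute f x)) }
      }

module _ (C : Category) where
  open Category C

  y : Obj → Presheaf C 0ℓ 0ℓ
  y K = record
    { ob            = λ A → record { Carrier = A ⇒ K ; _≈_ = _≈_ ; isEquivalence = equiv }
    ; restrict      = λ f g → g ∘ f
    ; restrict-cong = λ p q → ∘-cong q p
    ; restrict-id   = identityʳ
    ; restrict-∘    = λ f g h → ≈.sym (assoc h f g)
    }

  y₁ : ∀ {L K} (f : L ⇒ K) → IsNatural (y L) (y K) (λ _ g → f ∘ g)
  y₁ f = record
    { η-cong  = ∘-cong ≈.refl
    ; commute = λ g h → ≈.sym (assoc f h g)
    }

  -- Subpresheaves of y K are arbitrary Set-valued predicates, so Ω lives one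
  -- universe up; its equality is extensional equality of subpresheaves.
  Ω : Presheaf C (lsuc 0ℓ) 0ℓ
  Ω = record
    { ob            = λ K → record
        { Carrier = Subpresheaf (y K) ; _≈_ = _≐_ ; isEquivalence = ≐-isEquivalence }
    ; restrict      = λ f → pullback (y₁ f)
    ; restrict-cong = λ {_} {_} {_} {_} {U} {V} p (q , r) →
        (λ x m → q _ (mem-resp U (∘-cong p ≈.refl) m)) ,
        (λ x m → mem-resp U (∘-cong (≈.sym p) ≈.refl) (r _ m))
    ; restrict-id   = λ U →
        (λ x → mem-resp U (identityˡ x)) , (λ x → mem-resp U (≈.sym (identityˡ x)))
    ; restrict-∘    = λ f g U →
        (λ x → mem-resp U (assoc f g x)) , (λ x → mem-resp U (≈.sym (assoc f g x)))
    }

  record IsTopology (j : ∀ K → Subpresheaf (y K) → Subpresheaf (y K)) : Set₁ where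
    field
      natural    : IsNatural Ω Ω j
      top        : ∀ K → j K (full (y K)) ≐ full (y K)
      idempotent : ∀ K U → j K (j K U) ≐ j K U
      meet       : ∀ K U V → j K (U ∩ V) ≐ j K U ∩ j K V

-- The object k stands for {0 < … < k}, hence the successors.
record Monotone (l k : ℕ) : Set where
  field
    fun  : Fin (suc l) → Fin (suc k)
    mono : ∀ {a b} → a Fin.≤ b → fun a Fin.≤ fun b

record InjMonotone (l k : ℕ) : Set where
  field
    monotone  : Monotone l k
    injective : Injective _≡_ _≡_ (Monotone.fun monotone)
  open Monotone monotone public

open Monotone
open InjMonotone using (monotone; injective)

Δ : Category
Δ = record
  { Obj       = ℕ
  ; _⇒_       = Monotone
  ; _≈_       = λ f g → fun f ≗ fun g
  ; id        = record { fun = λ a → a ; mono = λ p → p }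
  ; _∘_       = λ f g → record { fun = λ a → fun f (fun g a) ; mono = λ p → mono f (mono g p) }
  ; equiv     = record
      { refl = λ _ → refl ; sym = λ p a → sym (p a) ; trans = λ p q a → trans (p a) (q a) }
  ; ∘-cong    = λ {_} {_} {_} {f} p q a → trans (cong (fun f) (q a)) (p _)
  ; identityˡ = λ _ _ → refl
  ; identityʳ = λ _ _ → refl
  ; assoc     = λ _ _ _ _ → refl
  }

private module Δ = Category Δ

Δ₊ : Category
Δ₊ = record
  { Obj       = ℕ
  ; _⇒_       = InjMonotone
  ; _≈_       = λ f g → monotone f Δ.≈ monotone g
  ; id        = record { monotone = Δ.id ; injective = λ p → p }
  ; _∘_       = λ f g → record
      { monotone = monotone f Δ.∘ monotone g ; injective = λ p → injective g (injective f p) }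
  ; equiv     = record
      { refl = λ _ → refl ; sym = λ p a → sym (p a) ; trans = λ p q a → trans (p a) (q a) }
  ; ∘-cong    = λ {_} {_} {_} {f} {f′} {g} {g′} →
      Δ.∘-cong {f = monotone f} {monotone f′} {monotone g} {monotone g′}
  ; identityˡ = λ _ _ → refl
  ; identityʳ = λ _ _ → refl
  ; assoc     = λ _ _ _ _ → refl
  }

private module Δ₊ = Category Δ₊

δ : ∀ {k} → Fin (suc (suc k)) → InjMonotone k (suc k)
δ i = record
  { monotone  = record { fun = punchIn i ; mono = Finₚ.punchIn-mono-≤ i _ _ }
  ; injective = Finₚ.punchIn-injective i _ _
  }

σ : ∀ {k} → Fin (suc k) → Monotone (suc k) k
σ i = record { fun = pinch i ; mono = Finₚ.pinch-mono-≤ i }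

y₊ : ℕ → Presheaf Δ₊ 0ℓ 0ℓ
y₊ = y Δ₊

Ω₊ : ℕ → Set₁
Ω₊ k = Subpresheaf (y₊ k)

face : ∀ {k} → Fin (suc (suc k)) → Ω₊ (suc k)
face i = ⟨ δ i ⟩

∂ : ∀ k → Ω₊ k
∂ zero    = empty (y₊ 0)
∂ (suc k) = ⋃ face

-- Tuples of elements of Ω₊ k are indexed so that component i corresponds to dᵢ.
incidence : ∀ {k} → Ω₊ (suc k) → Fin (suc (suc k)) → Ω₊ k
incidence x i = Presheaf.restrict (Ω Δ₊) (δ i) x

-- The only candidate for an element with incidence tuple z, provided that z is
-- not the tuple (y₊ k, …, y₊ k); see fromIncidence-unique.
fromIncidence : ∀ {k} → (Fin (suc (suc k)) → Ω₊ k) → Ω₊ (suc k)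
fromIncidence z = ⋃ (λ i → image (y₁ Δ₊ (δ i)) (z i))

through-face : ∀ {l k} (f : InjMonotone l (suc k)) →
               (∃₂ λ i g → f Δ₊.≈ (δ i Δ₊.∘ g)) ⊎ (∃ λ s → (f Δ₊.∘ s) Δ₊.≈ Δ₊.id)
through-face {l} {k} f with Finₚ.any? (λ i → Finₚ.all? (λ a → ¬? (i Finₚ.≟ InjMonotone.fun f a)))
... | yes (i , miss) = inj₁ (i , g , λ a → sym (Finₚ.punchIn-punchOut (miss a)))
  where
  g : InjMonotone l k
  g = record
    { monotone  = record
        { fun  = λ a → punchOut (miss a)
        ; mono = λ p → Finₚ.punchOut-mono-≤ (miss _) (miss _) (InjMonotone.mono f p) }
    ; injective = λ {a} {b} p → injective f (Finₚ.punchOut-injective (miss a) (miss b) p)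
    }
... | no ¬miss = inj₂ (s , λ i → sym (proj₂ (hit i)))
  where
  open InjMonotone f using () renaming (fun to φ; mono to φ-mono)

  hit : ∀ i → ∃ λ a → i ≡ φ a
  hit i with Finₚ.any? (λ a → i Finₚ.≟ φ a)
  ... | yes p = p
  ... | no ¬p = contradiction (i , λ a e → ¬p (a , e)) ¬miss

  s : InjMonotone (suc k) l
  s = record
    { monotone  = record { fun = λ i → proj₁ (hit i) ; mono = s-mono }
    ; injective = λ {i} {j} p → trans (proj₂ (hit i)) (trans (cong φ p) (sym (proj₂ (hit j))))
    }
    where
    s-mono : ∀ {i j} → i Fin.≤ j → proj₁ (hit i) Fin.≤ proj₁ (hit j)
    s-mono {i} {j} i≤j with Finₚ.≤-total (proj₁ (hit i)) (proj₁ (hit j))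
    ... | inj₁ p = p
    ... | inj₂ p = Finₚ.≤-reflexive (cong (λ t → proj₁ (hit t)) i≡j)
      where
      j≤i : j Fin.≤ i
      j≤i = subst (Fin._≤ i) (sym (proj₂ (hit j)))
              (subst (φ (proj₁ (hit j)) Fin.≤_) (sym (proj₂ (hit i))) (φ-mono p))

      i≡j : i ≡ j
      i≡j = Finₚ.≤-antisym i≤j j≤i

fromIncidence-unique : ∀ {k} (z : Fin (suc (suc k)) → Ω₊ k) (x : Ω₊ (suc k)) →
                       ¬ (∀ i → z i ≐ full (y₊ k)) → (∀ i → incidence x i ≐ z i) →
                       x ≐ fromIncidence z
fromIncidence-unique {k} z x z≢⊤ x∼z = to , from
  where
  to : x ⊆ fromIncidence z
  to f m with through-face f
  ... | inj₁ (i , g , e) = i , g , proj₁ (x∼z i) g (mem-resp x e m) , e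
  ... | inj₂ (s , e) = contradiction all-full z≢⊤
    where
    id∈x : mem x Δ₊.id
    id∈x = mem-resp x e (mem-restrict x s m)

    all-full : ∀ i → z i ≐ full (y₊ k)
    all-full i = (λ _ _ → tt) , (λ g _ → proj₁ (x∼z i) g (mem-restrict x (δ i Δ₊.∘ g) id∈x))

  from : fromIncidence z ⊆ x
  from f (i , g , m , e) = mem-resp x (λ a → sym (e a)) (proj₂ (x∼z i) g m)

module _ (em : ExcludedMiddle 0ℓ) where

  fill : ∀ {k} → Bool → Ω₊ k
  fill b = if b then full (y₊ _) else ∂ _

  extend : ∀ {k} → Bool → (Ω₊ k → Ω₊ k) → Ω₊ (suc k) → Ω₊ (suc k)
  extend {k} b jₖ x with em {x ≐ full (y₊ (suc k))}
  ... | yes _ = full (y₊ (suc k))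
  ... | no _ with em {x ≐ ∂ (suc k)}
  ...   | yes _ = fill b
  ...   | no _ with em {∀ i → jₖ (incidence x i) ≐ full (y₊ k)}
  ...     | yes _ = fill b
  ...     | no _  = fromIncidence (λ i → jₖ (incidence x i))

  -- The components at k ≤ n of the topology on n-dimensional semi-simplicial
  -- sets given by a word of length n + 1, with false for 0 and true for 1.
  -- Elements of the truncated Ω(k) are identified, via restriction to lower
  -- dimensions, with those of the untruncated one.
  j₊ : ∀ {n} → Vec Bool (suc n) → ∀ {k} → k ≤′ n → Ω₊ k → Ω₊ k
  j₊ {zero}  (b ∷ []) ≤′-refl       x = if b then full (y₊ 0) else x
  j₊ {suc n} w        ≤′-refl       x = extend (last w) (j₊ (init w) ≤′-refl) x
  j₊ {suc n} w        (≤′-step k≤n) x = j₊ (init w) k≤n x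

-- x(l) ⊆ y₊(k)(l) seen inside y(k)(l).
data NonDegen {k} (x : Ω₊ k) (l : ℕ) (f : Monotone l k) : Set where
  nonDegen : (g : InjMonotone l k) → mem x g → f Δ.≈ monotone g → NonDegen x l f

Degen : ∀ {k} → Ω₊ k → ∀ l → Monotone l k → Set
Degen     x zero    f = ⊥
Degen {k} x (suc l) f =
  ∃₂ λ (i : Fin (suc l)) (g : Monotone l k) → (NonDegen x l g ⊎ Degen x l g) × f Δ.≈ (g Δ.∘ σ i)

module _ {k : ℕ} where

  addDegen : Ω₊ k → ∀ l → Monotone l k → Set
  addDegen x l f = NonDegen x l f ⊎ Degen x l f

  addDegen-resp : ∀ (x : Ω₊ k) l {f g} → f Δ.≈ g → addDegen x l f → addDegen x l g
  addDegen-resp x l       e (inj₁ (nonDegen h m p)) =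
    inj₁ (nonDegen h m (λ a → trans (sym (e a)) (p a)))
  addDegen-resp x (suc l) e (inj₂ (i , h , m , p)) =
    inj₂ (i , h , m , λ a → trans (sym (e a)) (p a))

punchIn-pinch : ∀ {n} (i : Fin n) (a : Fin (suc n)) →
                punchIn (suc i) (pinch i a) ≡ a ⊎
                (a ≡ suc i × punchIn (suc i) (pinch i a) ≡ inject₁ i)
punchIn-pinch zero    zero          = inj₁ refl
punchIn-pinch zero    (suc zero)    = inj₂ (refl , refl)
punchIn-pinch zero    (suc (suc a)) = inj₁ refl
punchIn-pinch (suc i) zero          = inj₁ refl
punchIn-pinch (suc i) (suc a) with punchIn-pinch i a
... | inj₁ p       = inj₁ (cong suc p)
... | inj₂ (p , q) = inj₂ (cong suc p , cong suc q)

below : ∀ {n} (a b : Fin (suc n)) → a Fin.< b → ∃ λ i → a ≡ inject₁ i × suc i Fin.≤ b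
below {suc n} zero    (suc b) p       = zero , refl , s≤s z≤n
below {suc n} (suc a) (suc b) (s≤s p) with below a b p
... | i , e , q = suc i , cong suc e , s≤s q

injective-or-degenerate : ∀ {l k} (f : Monotone l k) → Injective _≡_ _≡_ (fun f) ⊎
  (∃₂ λ l′ (e : l ≡ suc l′) → ∃₂ λ (i : Fin (suc l′)) (g : Monotone l′ k) →
     subst (λ t → Monotone t k) e f Δ.≈ (g Δ.∘ σ i))
injective-or-degenerate {zero}  f = inj₁ λ { {zero} {zero} _ → refl }
injective-or-degenerate {suc l} f with Finₚ.any? (λ i → fun f (inject₁ i) Finₚ.≟ fun f (suc i))
... | yes (i , e) = inj₂ (l , refl , i , f Δ.∘ monotone (δ (suc i)) , fact)
  where
  fact : f Δ.≈ ((f Δ.∘ monotone (δ (suc i))) Δ.∘ σ i)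
  fact a with punchIn-pinch i a
  ... | inj₁ p       = cong (fun f) (sym p)
  ... | inj₂ (p , q) = trans (cong (fun f) p) (trans (sym e) (cong (fun f) (sym q)))
... | no distinct = inj₁ inj
  where
  strict : ∀ {a b} → a Fin.< b → fun f a ≢ fun f b
  strict {a} {b} a<b e with below a b a<b
  ... | i , refl , q = distinct (i , Finₚ.≤-antisym
          (mono f step)
          (subst (fun f (suc i) Fin.≤_) (sym e) (mono f q)))
    where
    step : inject₁ i Fin.≤ Fin.suc i
    step = ℕₚ.≤-trans (ℕₚ.≤-reflexive (Finₚ.toℕ-inject₁ i)) (ℕₚ.n≤1+n _)

  inj : Injective _≡_ _≡_ (fun f)
  inj {a} {b} e with ℕₚ.<-cmp (Fin.toℕ a) (Fin.toℕ b)
  ... | tri< p _ _ = contradiction e (strict p)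
  ... | tri≈ _ p _ = Finₚ.toℕ-injective p
  ... | tri> _ _ p = contradiction (sym e) (strict p)

nonDegen-restrict : ∀ {k} (x : Ω₊ k) {l} (g : InjMonotone l k) → mem x g →
                    ∀ {m} (h : Monotone m l) → addDegen x m (monotone g Δ.∘ h)
nonDegen-restrict x g p {m} h with injective-or-degenerate h
... | inj₁ inj = inj₁ (nonDegen (g Δ₊.∘ h₊) (mem-restrict x h₊ p) (λ _ → refl))
  where h₊ = record { monotone = h ; injective = inj }
... | inj₂ (m′ , refl , i , h′ , e) =
  inj₂ (i , monotone g Δ.∘ h′ , nonDegen-restrict x g p h′ , λ a → cong (InjMonotone.fun g) (e a))

addDegen-restrict : ∀ {k} (x : Ω₊ k) l {f : Monotone l k} → addDegen x l f →
                    ∀ {m} (h : Monotone m l) → addDegen x m (f Δ.∘ h)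
addDegen-restrict x l (inj₁ (nonDegen g p e)) {m} h =
  addDegen-resp x m (λ a → sym (e (fun h a))) (nonDegen-restrict x g p h)
addDegen-restrict x (suc l) (inj₂ (i , g , p , e)) {m} h =
  addDegen-resp x m (λ a → sym (e (fun h a))) (addDegen-restrict x l p (σ i Δ.∘ h))

pinch-inject₁ : ∀ {n} (i : Fin n) → pinch i (inject₁ i) ≡ pinch i (suc i)
pinch-inject₁ zero    = refl
pinch-inject₁ (suc i) = cong suc (pinch-inject₁ i)

inject₁≢suc : ∀ {n} (i : Fin n) → inject₁ i ≢ suc i
inject₁≢suc (suc i) e = inject₁≢suc i (Finₚ.suc-injective e)

F : ∀ k → Inverse (Presheaf.ob (Ω Δ₊) k) (Presheaf.ob (Ω Δ) k)
F k = record
  { to        = to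
  ; from      = from
  ; to-cong   = λ {x} {x′} (p , q) → to-mono {x} {x′} p , to-mono {x′} {x} q
  ; from-cong = λ (p , q) → (λ g → p (monotone g)) , (λ g → q (monotone g))
  ; inverse   =
      (λ {U} {x} (p , q) →
        (λ {l} f m → to-from₁ U l (to-mono {x} {from U} p f m)) ,
        (λ f m → to-mono {from U} {x} q f (to-from₂ U f m))) ,
      (λ {x} {U} (p , q) →
        (λ g m → from-to₁ x g (p (monotone g) m)) ,
        (λ g m → q (monotone g) (inj₁ (nonDegen g m (λ _ → refl)))))
  }
  where
  to : Ω₊ k → Subpresheaf (y Δ k)
  to x = record
    { mem          = λ {l} → addDegen x l
    ; mem-resp     = λ {l} → addDegen-resp x l
    ; mem-restrict = λ { {_} {l} h p → addDegen-restrict x l p h }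
    }

  from : Subpresheaf (y Δ k) → Ω₊ k
  from U = record
    { mem          = λ g → mem U (monotone g)
    ; mem-resp     = λ {l} {g} {g′} → mem-resp U {l} {monotone g} {monotone g′}
    ; mem-restrict = λ h {g} → mem-restrict U (monotone h) {monotone g}
    }

  to-mono : ∀ {x x′ : Ω₊ k} → x ⊆ x′ → to x ⊆ to x′
  to-mono           x⊆x′ {l}     f (inj₁ (nonDegen g m e))  = inj₁ (nonDegen g (x⊆x′ g m) e)
  to-mono {x} {x′} x⊆x′ {suc l} f (inj₂ (i , g , p , e)) =
    inj₂ (i , g , to-mono {x} {x′} x⊆x′ {l} g p , e)

  to-from₁ : ∀ U l {f} → addDegen (from U) l f → mem U f
  to-from₁ U l       (inj₁ (nonDegen g m e)) = mem-resp U (λ a → sym (e a)) m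
  to-from₁ U (suc l) (inj₂ (i , g , p , e)) =
    mem-resp U (λ a → sym (e a)) (mem-restrict U (σ i) (to-from₁ U l p))

  to-from₂ : ∀ U → U ⊆ to (from U)
  to-from₂ U {l} f m with injective-or-degenerate f
  ... | inj₁ inj = inj₁ (nonDegen (record { monotone = f ; injective = inj }) m (λ _ → refl))
  ... | inj₂ (l′ , refl , i , g , e) = inj₂ (i , g , to-from₂ U g
          (mem-resp U section (mem-restrict U s {g Δ.∘ σ i} (mem-resp U e m))) , e)
    where
    s = monotone (δ (suc i))

    section : ((g Δ.∘ σ i) Δ.∘ s) Δ.≈ g
    section a = cong (fun g) (pinch-punchIn i a)
      where
      pinch-punchIn : ∀ {n} (i : Fin n) a → pinch i (punchIn (suc i) a) ≡ a
      pinch-punchIn zero    zero    = refl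
      pinch-punchIn zero    (suc a) = refl
      pinch-punchIn (suc i) zero    = refl
      pinch-punchIn (suc i) (suc a) = cong suc (pinch-punchIn i a)

  from-to₁ : ∀ x {l} (g : InjMonotone l k) → mem (to x) (monotone g) → mem x g
  from-to₁ x g (inj₁ (nonDegen h m e)) = mem-resp x (λ a → sym (e a)) m
  from-to₁ x {suc l} g (inj₂ (i , h , _ , e)) = contradiction
    (injective g (trans (e (inject₁ i)) (trans (cong (fun h) (pinch-inject₁ i)) (sym (e (suc i))))))
    (inject₁≢suc i)

-- As j₊, for simplicial sets; meant for words of the form 0ᵐ1ⁿ⁺¹⁻ᵐ.
jₛ : ExcludedMiddle 0ℓ → ∀ {n} → Vec Bool (suc n) → ∀ {k} → k ≤′ n →
     Subpresheaf (y Δ k) → Subpresheaf (y Δ k)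
jₛ em w {k} k≤n U = Inverse.to (F k) (j₊ em w k≤n (Inverse.from (F k) U))

prefix : (ℕ → Bool) → ∀ n → Vec Bool (suc n)
prefix w zero    = w 0 ∷ []
prefix w (suc n) = prefix w n ∷ʳ w (suc n)

data Variant : Set where
  sSet₊ sSet : Variant

-- The index category of the presheaf category 𝒟.
Index : Variant → Category
Index sSet₊ = Δ₊
Index sSet  = Δ

Admissible : Variant → (ℕ → Bool) → Set
Admissible sSet₊ w = Unit
Admissible sSet  w =
  (∀ n → w n ≡ false) ⊎
  (∃ λ m → (∀ n → n ℕ.< m → w n ≡ false) × (∀ n → m ℕ.≤ n → w n ≡ true))

jʷ : ExcludedMiddle 0ℓ → ∀ 𝒟 → (ℕ → Bool) →
     ∀ n → Subpresheaf (y (Index 𝒟) n) → Subpresheaf (y (Index 𝒟) n)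
jʷ em sSet₊ w n = j₊ em (prefix w n) ≤′-refl
jʷ em sSet  w n = jₛ em (prefix w n) ≤′-refl

-- For a word w, call an object M of the index category visible if w M = 0.  The
-- operator sending a sieve U to the sieve of those f with f ∘ g ∈ U for all g with
-- visible domain is a topology on presheaves over any category (closure below).
--
-- Conversely, let j be a topology, and let w M = 1 exactly when the largest proper
-- sieve on M, that of the maps without a section, is j-dense.  If every map
-- without a section factors through a smaller object, then j is the closure
-- operator of w, by well-founded induction on the object.
--
-- On Δ₊ the recursively defined topologies are these closure operators.  On Δ
-- the same holds if no 1 in w is followed by a 0, since the mono part of a map has
-- a domain no larger than the map does; and the word of a topology has this form,
-- as the largest proper sieve on k pulls back along σ to a proper sieve on k + 1.
module Submission where

open import Defs
open import Axiom.ExcludedMiddle using (ExcludedMiddle)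
open import Data.Bool using (Bool; true; false)
open import Data.Bool.Properties using (¬-not)
open import Data.Fin using (Fin; zero; suc; punchIn; pinch)
import Data.Fin.Properties as Finₚ
open import Data.Nat using (ℕ; zero; suc; s≤s⁻¹; _≤_; _<_; _≤′_; ≤′-refl; ≤′-step)
import Data.Nat.Properties as ℕₚ
open import Data.Nat.Induction using (<-wellFounded)
open import Data.Product using (∃; ∃₂; _×_; _,_; proj₁; proj₂; swap)
open import Data.Sum using (_⊎_; inj₁; inj₂)
open import Data.Unit using (tt)
open import Data.Vec.Properties using (init-∷ʳ; last-∷ʳ)
open import Function using (Inverse)
open import Induction.WellFounded using (WellFounded; Acc; acc)
open import Level using (0ℓ)
open import Relation.Binary using (Rel)
open import Relation.Binary.PropositionalEquality
  using (_≡_; refl; sym; trans; cong; subst)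
import Relation.Binary.Reasoning.Setoid as SetoidReasoning
open import Relation.Nullary using (¬_; yes; no; does; contradiction)
open import Relation.Nullary.Decidable using (dec-true)

-- Closure operators on presheaves over an arbitrary category

module ≐-Reasoning C K = SetoidReasoning (Presheaf.ob (Ω C) K)

module _ (C : Category) where
  open Category C

  private
    Op : Set₁
    Op = ∀ K → Subpresheaf (y C K) → Subpresheaf (y C K)

  IsTopology-resp : {j j′ : Op} → (∀ K U → j K U ≐ j′ K U) → IsTopology C j → IsTopology C j′
  IsTopology-resp {j} {j′} e t = record
    { natural    = record
        { η-cong  = λ {K} {U} {V} → cong′ {K} {U} {V}
        ; commute = λ {L} {K} f U → let open ≐-Reasoning C L in begin
            j′ L (pullback (y₁ C f) U)  ≈⟨ e L (pullback (y₁ C f) U) ⟨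
            j L (pullback (y₁ C f) U)   ≈⟨ commute f U ⟩
            pullback (y₁ C f) (j K U)   ≈⟨ (λ g → proj₁ (e K U) (f ∘ g)) ,
                                           (λ g → proj₂ (e K U) (f ∘ g)) ⟩
            pullback (y₁ C f) (j′ K U)  ∎
        }
    ; top        = λ K → let open ≐-Reasoning C K in begin
        j′ K (full (y C K))  ≈⟨ e K (full (y C K)) ⟨
        j K (full (y C K))   ≈⟨ top K ⟩
        full (y C K)         ∎
    ; idempotent = λ K U → let open ≐-Reasoning C K in begin
        j′ K (j′ K U)  ≈⟨ e K (j′ K U) ⟨
        j K (j′ K U)   ≈⟨ η-cong (e K U) ⟨
        j K (j K U)    ≈⟨ idempotent K U ⟩
        j K U          ≈⟨ e K U ⟩
        j′ K U         ∎
    ; meet       = λ K U V → let open ≐-Reasoning C K in begin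
        j′ K (U ∩ V)     ≈⟨ e K (U ∩ V) ⟨
        j K (U ∩ V)      ≈⟨ meet K U V ⟩
        j K U ∩ j K V    ≈⟨ (λ f (p , q) → proj₁ (e K U) f p , proj₁ (e K V) f q) ,
                            (λ f (p , q) → proj₂ (e K U) f p , proj₂ (e K V) f q) ⟩
        j′ K U ∩ j′ K V  ∎
    }
    where
    open IsTopology t
    open IsNatural natural

    cong′ : ∀ {K} {U V : Subpresheaf (y C K)} → U ≐ V → j′ K U ≐ j′ K V
    cong′ {K} {U} {V} p = begin
      j′ K U  ≈⟨ e K U ⟨
      j K U   ≈⟨ η-cong p ⟩
      j K V   ≈⟨ e K V ⟩
      j′ K V  ∎
      where open ≐-Reasoning C K

  closure : (Obj → Bool) → Op
  closure w K U = record
    { mem          = λ {A} f → ∀ {M} (g : M ⇒ A) → w M ≡ false → mem U (f ∘ g)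
    ; mem-resp     = λ e m g p → mem-resp U (∘-cong e ≈.refl) (m g p)
    ; mem-restrict = λ h m g p → mem-resp U (≈.sym (assoc _ h g)) (m (h ∘ g) p)
    }

  closure-mono : ∀ w {K} {U V : Subpresheaf (y C K)} → U ⊆ V → closure w K U ⊆ closure w K V
  closure-mono w U⊆V f m g p = U⊆V (f ∘ g) (m g p)

  closure-commute : ∀ w {L K} (f : L ⇒ K) U →
                    closure w L (pullback (y₁ C f) U) ≐ pullback (y₁ C f) (closure w K U)
  closure-commute w f U =
    (λ h m g p → mem-resp U (≈.sym (assoc f h g)) (m g p)) ,
    (λ h m g p → mem-resp U (assoc f h g) (m g p))

  closure-isTopology : ∀ w → IsTopology C (closure w)
  closure-isTopology w = record
    { natural    = record
        { η-cong  = λ {_} {U} {V} (p , q) →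
            closure-mono w {U = U} {V} p , closure-mono w {U = V} {U} q
        ; commute = closure-commute w
        }
    ; top        = λ K → (λ _ _ → tt) , (λ _ _ _ _ → tt)
    ; idempotent = λ K U →
        -- The domain of `g` is visible, so its identity may serve as the test map of the inner
        -- closure.
        (λ f m g p → mem-resp U (identityʳ (f ∘ g)) (m g p id p)) ,
        (λ f m g p h q → mem-resp U (≈.sym (assoc f g h)) (m (g ∘ h) q))
    ; meet       = λ K U V →
        (λ f m → (λ g p → proj₁ (m g p)) , (λ g p → proj₂ (m g p))) ,
        (λ f (m , n) g p → m g p , n g p)
    }

  -- Density of largest proper sieves, and the word of a topology

  HasSection : ∀ {L K} → L ⇒ K → Set
  HasSection f = ∃ λ s → f ∘ s ≈ id

  noSection : ∀ K → Subpresheaf (y C K)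
  noSection K = record
    { mem          = λ f → ¬ HasSection f
    ; mem-resp     = λ e ¬s (s , p) → ¬s (s , ≈.trans (∘-cong e ≈.refl) p)
    ; mem-restrict = λ h ¬s (s , p) → ¬s (h ∘ s , ≈.trans (≈.sym (assoc _ h s)) p)
    }

  id∈⇒full : ∀ {K} (U : Subpresheaf (y C K)) → mem U id → full (y C K) ⊆ U
  id∈⇒full U m f _ = mem-resp U (identityˡ f) (mem-restrict U f m)

  -- A sieve containing a map with a section contains the identity. This makes `noSection K` the
  -- largest proper sieve.
  id∉⇒⊆noSection : ∀ {K} (U : Subpresheaf (y C K)) → ¬ mem U id → U ⊆ noSection K
  id∉⇒⊆noSection U id∉U f m (s , p) = id∉U (mem-resp U p (mem-restrict U s m))

  ReducesAlong : Rel Obj 0ℓ → Set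
  ReducesAlong _≺_ = ∀ {L K} (f : L ⇒ K) →
    HasSection f ⊎ (∃ λ K′ → K′ ≺ K × ∃₂ λ (h : K′ ⇒ K) (g : L ⇒ K′) → f ≈ h ∘ g)

  module _ {j : Op} (topology : IsTopology C j) where
    open IsTopology topology
    open IsNatural natural

    -- Inclusion `U ⊆ V` amounts to `U ≐ U ∩ V`, and `j` preserves meets.
    j-mono : ∀ {K} {U V : Subpresheaf (y C K)} → U ⊆ V → j K U ⊆ j K V
    j-mono {K} {U} {V} U⊆V f m = proj₂ (proj₁ (meet K U V) f (proj₁ (η-cong U≐U∩V) f m))
      where
      U≐U∩V : U ≐ U ∩ V
      U≐U∩V = (λ g p → p , U⊆V g p) , (λ g p → proj₁ p)

    -- Naturality of `j`, read at the identity. It reduces questions about arbitrary maps to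
    -- questions about identities, in which density and the induction below are phrased.
    ∈j⇔id∈j-pullback : ∀ {L K} (f : L ⇒ K) U →
      (mem (j K U) f → mem (j L (pullback (y₁ C f) U)) id) ×
      (mem (j L (pullback (y₁ C f) U)) id → mem (j K U) f)
    ∈j⇔id∈j-pullback {L} {K} f U =
      (λ m → proj₂ (commute f U) id (mem-resp (j K U) (≈.sym (identityʳ f)) m)) ,
      (λ m → mem-resp (j K U) (identityʳ f) (proj₁ (commute f U) id m))

    -- Pulled back along one of its own members, `U` becomes full, and `j` preserves the full sieve.
    j-inflationary : ∀ K U → U ⊆ j K U
    j-inflationary K U f m = proj₂ (∈j⇔id∈j-pullback f U)
      (j-mono {U = full (y C _)} (λ g _ → mem-restrict U g m) id (proj₂ (top _) id tt))

    module _ (em : ExcludedMiddle 0ℓ) where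

      Dense : Obj → Set
      Dense K = mem (j K (noSection K)) id

      word : Obj → Bool
      word K = does (em {Dense K})

      word-true : ∀ {K} → Dense K → word K ≡ true
      word-true = dec-true em

      word-dense : ∀ {K} → word K ≡ true → Dense K
      word-dense {K} p with em {Dense K}
      ... | yes d = d
      word-dense () | no _

      -- If `f` is in `j K U` but `f ∘ g` is not in `U`, the pullback of `U` along `f ∘ g` is a
      -- proper sieve that is dense. The larger `noSection M` is then dense too, so `M` is not
      -- visible.
      j⊆closure : ∀ K U → j K U ⊆ closure word K U
      j⊆closure K U f m {M} g p with em {mem U (f ∘ g)}
      ... | yes q = q
      ... | no ¬q = contradiction (trans (sym p) (word-true dense)) λ ()
        where
        V : Subpresheaf (y C M)
        V = pullback (y₁ C (f ∘ g)) U

        dense : Dense M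
        dense = j-mono {U = V}
          (id∉⇒⊆noSection V (λ r → ¬q (mem-resp U (identityʳ (f ∘ g)) r))) id
          (proj₁ (∈j⇔id∈j-pullback (f ∘ g) U) (mem-restrict (j K U) g m))

      module _ {_≺_ : Rel Obj 0ℓ} (wf : WellFounded _≺_) (reduce : ReducesAlong _≺_) where

        private
          -- If `K` is visible, its identity is a test map. Otherwise `noSection K` is dense, and by
          -- idempotence it suffices to place it inside `j K U`: a map without a section factors
          -- through a smaller `K′`, where the induction hypothesis applies to the pullback of `U`.
          id∈closure⇒id∈j : ∀ {K} → Acc _≺_ K → ∀ U → mem (closure word K U) id → mem (j K U) id
          id∈closure⇒id∈j {K} (acc rs) U m with word K in eq
          ... | false = j-inflationary K U id (mem-resp U (identityˡ id) (m id eq))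
          ... | true  = proj₁ (idempotent K U) id
                          (j-mono {U = noSection K} noSection⊆jU id (word-dense eq))
            where
            noSection⊆jU : noSection K ⊆ j K U
            noSection⊆jU f ¬s with reduce f
            ... | inj₁ s = contradiction s ¬s
            ... | inj₂ (K′ , K′≺K , h , g , e) =
              mem-resp (j K U) (≈.sym e) (mem-restrict (j K U) g h∈jU)
              where
              h∈jU : mem (j K U) h
              h∈jU = proj₂ (∈j⇔id∈j-pullback h U)
                (id∈closure⇒id∈j (rs K′≺K) (pullback (y₁ C h) U)
                  (λ g′ p → mem-resp U
                    (≈.trans (identityˡ _) (∘-cong ≈.refl (≈.sym (identityˡ g′)))) (m (h ∘ g′) p)))

        j≐closure : ∀ K U → j K U ≐ closure word K U
        j≐closure K U = j⊆closure K U , λ f m →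
          proj₂ (∈j⇔id∈j-pullback f U) (id∈closure⇒id∈j (wf _) (pullback (y₁ C f) U)
            (λ g p → mem-resp U (∘-cong ≈.refl (≈.sym (identityˡ g))) (m g p)))

-- Semi-simplicial sets

private
  module Δ = Category Δ
  module Δ₊ = Category Δ₊

open Monotone
open InjMonotone using (monotone; injective)

-- Into 0, any vertex of the nonempty domain is a section. Into a successor, a map misses a point
-- and lies in a face, or is onto and has a section.
Δ₊-reduces : ReducesAlong Δ₊ _<_
Δ₊-reduces {K = zero}  f = inj₁ (vertex , λ { zero → Fin1 _ })
  where
  Fin1 : (a : Fin 1) → a ≡ zero
  Fin1 zero = refl

  vertex : InjMonotone 0 _
  vertex = record
    { monotone  = record { fun = λ _ → zero ; mono = λ _ → ℕₚ.≤-refl }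
    ; injective = λ { {zero} {zero} _ → refl }
    }
Δ₊-reduces {K = suc k} f with through-face f
... | inj₁ (i , g , e) = inj₂ (k , ℕₚ.n<1+n k , δ i , g , e)
... | inj₂ s           = inj₁ s

injection-≤ : ∀ {l k} → InjMonotone l k → l ≤ k
injection-≤ f = s≤s⁻¹ (Finₚ.injective⇒≤ (injective f))

module _ (em : ExcludedMiddle 0ℓ) (w : ℕ → Bool) where

  private
    cl : ∀ {k} → Ω₊ k → Ω₊ k
    cl = closure Δ₊ w _

  -- Serves both branches of `extend` that return `fill b`. The last hypothesis puts every map with
  -- visible domain that factors through a face into `x`, so only maps with a section remain, and
  -- the letter at `suc k` decides about them.
  fill≐closure : ∀ {k b} → w (suc k) ≡ b → (x : Ω₊ (suc k)) → ¬ (x ≐ full (y₊ (suc k))) →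
                 (∀ i → full (y₊ k) ⊆ cl (incidence x i)) → fill em b ≐ cl x
  fill≐closure {k} {b} w≡b x x≢⊤ full⊆ = to b w≡b , from b w≡b
    where
    face∈ : ∀ {M} i (g : InjMonotone M k) → w M ≡ false → mem x (δ i Δ₊.∘ g)
    face∈ i g p = full⊆ i g tt Δ₊.id p

    to : ∀ b → w (suc k) ≡ b → fill em b ⊆ cl x
    to true  e f _ {M} g p with through-face (f Δ₊.∘ g)
    ... | inj₁ (i , h , q) = mem-resp x (λ a → sym (q a)) (face∈ i h p)
    -- Injections both ways force `M` to be `suc k`, whose letter is 1, although `M` is visible.
    ... | inj₂ (s , _)     = contradiction (trans (sym e) (subst (λ n → w n ≡ false) M≡suc-k p)) λ ()
      where
      M≡suc-k : M ≡ suc k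
      M≡suc-k = ℕₚ.≤-antisym (injection-≤ (f Δ₊.∘ g)) (injection-≤ s)
    to false e f (i , h , q) g p =
      mem-resp x (λ a → sym (q (InjMonotone.fun g a))) (face∈ i (h Δ₊.∘ g) p)

    from : ∀ b → w (suc k) ≡ b → cl x ⊆ fill em b
    from true  e f m = tt
    from false e f m with through-face f
    ... | inj₁ q       = q
    -- Here `suc k` is visible, so `s` is a test map and puts the identity into `x`.
    ... | inj₂ (s , q) = contradiction x≐full x≢⊤
      where
      x≐full : x ≐ full (y₊ (suc k))
      x≐full = (λ _ _ → tt) , id∈⇒full Δ₊ x (mem-resp x q (m s e))

  extend≐closure : ∀ {k} (jₖ : Ω₊ k → Ω₊ k) → (∀ x → jₖ x ≐ cl x) →
                   ∀ x → extend em (w (suc k)) jₖ x ≐ cl x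
  extend≐closure {k} jₖ jₖ≐cl x with em {x ≐ full (y₊ (suc k))}
  ... | yes (_ , full⊆x) = (λ f _ g _ → full⊆x (f Δ₊.∘ g) tt) , (λ _ _ → tt)
  ... | no x≢⊤ with em {x ≐ ∂ (suc k)}
  ...   | yes (_ , ∂⊆x) = fill≐closure refl x x≢⊤
            (λ i h _ g _ → ∂⊆x (δ i Δ₊.∘ (h Δ₊.∘ g)) (i , h Δ₊.∘ g , λ _ → refl))
  ...   | no _ with em {∀ i → jₖ (incidence x i) ≐ full (y₊ k)}
  ...     | yes all-full = fill≐closure refl x x≢⊤
              (λ i h _ → proj₁ (jₖ≐cl (incidence x i)) h (proj₂ (all-full i) h tt))
  -- Closure commutes with pullback along `δ i`, so `cl x` has the incidence tuple used by the
  -- recursion; as its entries are not all full, it determines `cl x`.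
  ...     | no ¬all-full = swap (fromIncidence-unique (λ i → jₖ (incidence x i)) (cl x) ¬all-full
              (λ i → let open ≐-Reasoning Δ₊ k in begin
                incidence (cl x) i  ≈⟨ closure-commute Δ₊ w (δ i) x ⟨
                cl (incidence x i)  ≈⟨ jₖ≐cl (incidence x i) ⟨
                jₖ (incidence x i)  ∎))

  jʷ₊≐closure : ∀ n x → jʷ em sSet₊ w n x ≐ closure Δ₊ w n x
  jʷ₊≐closure zero x with w 0 in eq
  -- Only 0 injects into 0, so the letter `w 0` alone decides: there are no test maps if it is 1,
  -- and the identity is one if it is 0.
  ... | true = (λ { f _ {M} g p → contradiction
                      (trans (sym eq) (subst (λ n → w n ≡ false) (M≡0 f g) p)) λ () }) , (λ _ _ → tt)
    where
    M≡0 : ∀ {L M} → InjMonotone L 0 → InjMonotone M L → M ≡ 0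
    M≡0 f g = ℕₚ.n≤0⇒n≡0 (injection-≤ (f Δ₊.∘ g))
  ... | false = (λ f m g _ → mem-restrict x g m) , λ f m →
    mem-resp x (λ _ → refl) (m Δ₊.id (subst (λ n → w n ≡ false) (sym (ℕₚ.n≤0⇒n≡0 (injection-≤ f))) eq))
  jʷ₊≐closure (suc n) x
    rewrite init-∷ʳ (w (suc n)) (prefix w n) | last-∷ʳ (w (suc n)) (prefix w n) =
    extend≐closure (jʷ em sSet₊ w n) (jʷ₊≐closure n) x

-- Simplicial sets

pinch-punchIn : ∀ {n} (i : Fin n) a → pinch i (punchIn (suc i) a) ≡ a
pinch-punchIn zero    zero    = refl
pinch-punchIn zero    (suc a) = refl
pinch-punchIn (suc i) zero    = refl
pinch-punchIn (suc i) (suc a) = cong suc (pinch-punchIn i a)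

-- The bound `mid≤` is what carries visibility from `l` to `mid` when the zeros of the word are
-- closed downwards; the section makes the epi part split.
record EpiMono {l k} (f : Monotone l k) : Set where
  field
    {mid}      : ℕ
    mid≤       : mid ≤ l
    mono-part  : InjMonotone mid k
    epi-part   : Monotone l mid
    section    : Monotone mid l
    factors    : f Δ.≈ (monotone mono-part Δ.∘ epi-part)
    is-section : (epi-part Δ.∘ section) Δ.≈ Δ.id

-- Degeneracies are split off one by one until an injection remains; each `σ i` has the section
-- `δ (suc i)`.
epiMono : ∀ {l k} (f : Monotone l k) → EpiMono f
epiMono f with injective-or-degenerate f
... | inj₁ inj = record
  { mid≤       = ℕₚ.≤-refl
  ; mono-part  = record { monotone = f ; injective = inj }
  ; epi-part   = Δ.id
  ; section    = Δ.id
  ; factors    = λ _ → refl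
  ; is-section = λ _ → refl
  }
... | inj₂ (l , refl , i , g , e) = record
  { mid≤       = ℕₚ.m≤n⇒m≤1+n G.mid≤
  ; mono-part  = G.mono-part
  ; epi-part   = G.epi-part Δ.∘ σ i
  ; section    = monotone (δ (suc i)) Δ.∘ G.section
  ; factors    = λ a → trans (e a) (G.factors (pinch i a))
  ; is-section = λ a → trans (cong (fun G.epi-part) (pinch-punchIn i _)) (G.is-section a)
  }
  where module G = EpiMono (epiMono g)

-- The epi part is split, so everything depends on the mono part, a map of `Δ₊`.
Δ-reduces : ReducesAlong Δ _<_
Δ-reduces f with epiMono f
... | record { mono-part = h ; epi-part = s ; section = t ; factors = e ; is-section = st≈id }
  with Δ₊-reduces h
... | inj₁ (r , hr≈id) = inj₁ (t Δ.∘ monotone r , λ a →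
        trans (e _) (trans (cong (InjMonotone.fun h) (st≈id _)) (hr≈id a)))
... | inj₂ (K , K<k , h′ , g , e′) =
        inj₂ (K , K<k , monotone h′ , monotone g Δ.∘ s , λ a → trans (e a) (e′ _))

module _ (em : ExcludedMiddle 0ℓ) where

  -- As `F n` is a bijection, it suffices to compare both sides on injections. The difference lies
  -- in the test maps, which are all monotone maps on one side and injections on the other.
  jʷₛ≐closure : ∀ w → (∀ {m n} → m ≤ n → w n ≡ false → w m ≡ false) →
                ∀ n U → jʷ em sSet w n U ≐ closure Δ w n U
  jʷₛ≐closure w zeros-closed n U = proj₁ (Inverse.inverse (F n)) {closure Δ w n U} (begin
    jʷ em sSet₊ w n U₊                   ≈⟨ jʷ₊≐closure em w n U₊ ⟩
    closure Δ₊ w n U₊                    ≈⟨ (λ g → extends g) , (λ g → restricts g) ⟩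
    Inverse.from (F n) (closure Δ w n U)  ∎)
    where
    open ≐-Reasoning Δ₊ n

    U₊ : Ω₊ n
    U₊ = Inverse.from (F n) U

    restricts : ∀ {L} (g : InjMonotone L n) → mem (closure Δ w n U) (monotone g) →
                mem (closure Δ₊ w n U₊) g
    restricts g m h = m (monotone h)

    extends : ∀ {L} (g : InjMonotone L n) → mem (closure Δ₊ w n U₊) g →
              mem (closure Δ w n U) (monotone g)
    -- The mono part of `h` has a visible domain by `zeros-closed`, and `U` is closed under
    -- precomposition with the epi part.
    extends g m h p = mem-resp U (λ a → cong (InjMonotone.fun g) (sym (factors a)))
      (mem-restrict U epi-part {monotone g Δ.∘ monotone mono-part} (m mono-part (zeros-closed mid≤ p)))
      where open EpiMono (epiMono h)

-- Admissible words

admissible⇒zeros-closed : ∀ w → Admissible sSet w → ∀ {m n} → m ≤ n → w n ≡ false → w m ≡ false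
admissible⇒zeros-closed w (inj₁ zeros) m≤n _ = zeros _
admissible⇒zeros-closed w (inj₂ (k , zeros , ones)) {m} {n} m≤n p = zeros m (ℕₚ.≰⇒> λ k≤m →
  contradiction (trans (sym p) (ones n (ℕₚ.≤-trans k≤m m≤n))) λ ())

first-one : ∀ (w : ℕ → Bool) n →
            (∀ m → m < n → w m ≡ false) ⊎ (∃ λ k → (∀ m → m < k → w m ≡ false) × w k ≡ true)
first-one w zero = inj₁ λ _ ()
first-one w (suc n) with first-one w n
... | inj₂ found = inj₂ found
... | inj₁ zeros with w n in eq
...   | true  = inj₂ (n , zeros , eq)
...   | false = inj₁ λ m m<1+n → case (ℕₚ.m<1+n⇒m<n∨m≡n m<1+n)
  where
  case : ∀ {m} → m < n ⊎ m ≡ n → w m ≡ false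
  case (inj₁ m<n)  = zeros _ m<n
  case (inj₂ refl) = eq

ones-persist⇒admissible : ExcludedMiddle 0ℓ → ∀ w → (∀ n → w n ≡ true → w (suc n) ≡ true) →
                          Admissible sSet w
ones-persist⇒admissible em w persist with em {∃ λ n → w n ≡ true}
... | no none = inj₁ λ n → ¬-not λ e → none (n , e)
-- The search runs below `suc n` so that it includes `n`, where a 1 is known.
... | yes (n , e) with first-one w (suc n)
...   | inj₁ zeros = contradiction (trans (sym e) (zeros n (ℕₚ.n<1+n n))) λ ()
...   | inj₂ (k , zeros , w-k) = inj₂ (k , zeros , λ m k≤m → ones (ℕₚ.≤⇒≤′ k≤m))
  where
  ones : ∀ {m} → k ≤′ m → w m ≡ true
  ones ≤′-refl       = w-k
  ones (≤′-step k≤m) = persist _ (ones k≤m)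

-- By naturality the pullback of a dense sieve on `n` along `σ zero` is dense. It lies in
-- `noSection Δ (suc n)`, which is therefore dense as well.
topology⇒ones-persist : (em : ExcludedMiddle 0ℓ) → ∀ {j} (t : IsTopology Δ j) →
                        ∀ n → word Δ t em n ≡ true → word Δ t em (suc n) ≡ true
topology⇒ones-persist em {j} t n e = word-true Δ t em
    (j-mono Δ t {U = V} {noSection Δ (suc n)} V⊆noSection Δ.id id∈jV)
  where
  V : Subpresheaf (y Δ (suc n))
  V = pullback (y₁ Δ (σ zero)) (noSection Δ n)

  V⊆noSection : V ⊆ noSection Δ (suc n)
  -- Since `δ 1` is a section of `σ 0`, a section of `f` would give one of `σ 0 ∘ f`.
  V⊆noSection f ¬s (s , p) = ¬s (s Δ.∘ monotone (δ (suc zero)) , λ a →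
    trans (cong (pinch zero) (p _)) (pinch-punchIn zero a))

  id∈jV : mem (j (suc n) V) Δ.id
  id∈jV = proj₁ (∈j⇔id∈j-pullback Δ t (σ zero) (noSection Δ n))
    (id∈⇒full Δ (j n (noSection Δ n)) (word-dense Δ t em e) (σ zero) tt)

-- Classification of the topologies in both variants

theorem48 : (em : ExcludedMiddle 0ℓ) (𝒟 : Variant) →
    ((w : ℕ → Bool) → Admissible 𝒟 w → IsTopology (Index 𝒟) (jʷ em 𝒟 w))
    × (∀ j → IsTopology (Index 𝒟) j →
    ∃ λ (w : ℕ → Bool) → Admissible 𝒟 w × (∀ n x → j n x ≐ jʷ em 𝒟 w n x))
theorem48 em sSet₊ =
  (λ w _ → IsTopology-resp Δ₊ (λ n x → swap (jʷ₊≐closure em w n x)) (closure-isTopology Δ₊ w)) ,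
  (λ j t → word Δ₊ t em , tt , λ n x → let open ≐-Reasoning Δ₊ n in begin
    j n x                           ≈⟨ j≐closure Δ₊ t em <-wellFounded Δ₊-reduces n x ⟩
    closure Δ₊ (word Δ₊ t em) n x   ≈⟨ jʷ₊≐closure em (word Δ₊ t em) n x ⟨
    jʷ em sSet₊ (word Δ₊ t em) n x  ∎)
theorem48 em sSet =
  (λ w adm → IsTopology-resp Δ
    (λ n U → swap (jʷₛ≐closure em w (admissible⇒zeros-closed w adm) n U))
    (closure-isTopology Δ w)) ,
  (λ j t → let
      w   = word Δ t em
      adm = ones-persist⇒admissible em w (topology⇒ones-persist em t)
    in w , adm , λ n U → let open ≐-Reasoning Δ n in begin
      j n U             ≈⟨ j≐closure Δ t em <-wellFounded Δ-reduces n U ⟩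
      closure Δ w n U   ≈⟨ jʷₛ≐closure em w (admissible⇒zeros-closed w adm) n U ⟨
      jʷ em sSet w n U  ∎)
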